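{- Let $(G,i)$ be a filter pair over the signature $\Sigma$ and $A$ a $\Sigma$-structure. For $\Gamma\cup\{\varphi\}\subseteq A$ define $$\Gamma\vdash_G^A\varphi\quad\text{iff}\quad\text{for every }a\in G(A),\ \Gamma\subseteq i_A(a)\text{ implies }\varphi\in i_A(a).$$ Then $(A,\vdash_G^A)$ is an abstract logic, i.e. $\vdash_G^A$ is a Tarskian consequence relation on $A$.
   Context: $\Sigma$-Str is the category of $\Sigma$-structures and homomorphisms. $AL$ is the category of algebraic lattices with maps preserving arbitrary meets and directed joins. A filter pair over $\Sigma$ is a pair $(G,i)$ of a contravariant functor $G:\Sigma\text{ -Str}\to AL$ and maps $i_A:G(A)\to(\mathcal{P}(A),\subseteq)$, one for each $\Sigma$-structure $A$, preserving arbitrary infima (in particular $i_A(\top)=A$) and directed suprema, such that $i_A\circ G(h)=h^{ -1}\circ i_B$ for every homomorphism $h:A\to B$. A Tarskian consequence relation on a $\Sigma$-structure $A$ is a relation $\vdash\subseteq\mathcal{P}(A)\times A$ such that: (reflexivity) $\varphi\in\Gamma$ implies $\Gamma\vdash\varphi$; (cut) if $\Gamma\vdash\varphi$ and $\Delta\vdash\psi$ for every $\psi\in\Gamma$, then $\Delta\vdash\varphi$; (monotonicity) if $\Gamma\subseteq\Delta$ and $\Gamma\vdash\varphi$ then $\Delta\vdash\varphi$; (finitarity) if $\Gamma\vdash\varphi$ then $\Delta\vdash\varphi$ for some finite $\Delta\subseteq\Gamma$; (structurality) if $\Gamma\vdash\varphi$ and $\sigma$ is an endomorphism of $A$, then $\sigma[\Gamma]\vdash\sigma(\varphi)$.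 An abstract logic is a pair of a $\Sigma$-structure and a Tarskian consequence relation on it. -}

module Defs where

open import Level using (Level; suc; _⊔_)
open import Data.List.Base using (List)
open import Data.List.Membership.Propositional renaming (_∈_ to _∈ₗ_) using ()
open import Data.Nat.Base using (ℕ)
open import Data.Product.Base using (Σ-syntax; ∃; ∃-syntax; _×_; proj₁)
open import Data.Vec.Base using (Vec; map)
open import Data.Vec.Properties using (map-id; map-∘)
open import Function.Base using (_∘_; id)
open import Relation.Binary.Bundles using (Poset)
open import Relation.Binary.Core using (REL)
open import Relation.Binary.PropositionalEquality
  using (_≡_; _≗_; sym; trans; cong; subst)
open import Relation.Unary using (Pred; _∈_; _⊆_; _≐_; _⊢_)
open import Relation.Unary.Relation.Binary.Subset using (⊆-poset)

-- Throughout, "small" means living in `Set ℓ` for one fixed level ℓ: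
-- structures, lattices, subsets and the index types of meets and joins are all
-- small.

------------------------------------------------------------------------
-- Σ-Str

-- Function and relation symbols of finite arity; the purely algebraic
-- signatures are those for which every `Relations n` is empty.
record Signature (ℓ : Level) : Set (suc ℓ) where
  field
    Operations : ℕ → Set ℓ
    Relations  : ℕ → Set ℓ

record Structure {ℓ : Level} (S : Signature ℓ) : Set (suc ℓ) where
  open Signature S
  field
    Carrier : Set ℓ
    op      : ∀ {n} → Operations n → Vec Carrier n → Carrier
    rel     : ∀ {n} → Relations n → Pred (Vec Carrier n) ℓ

open Structure using (Carrier)

module _ {ℓ : Level} {S : Signature ℓ} where

  open Signature S

  record Hom (A B : Structure S) : Set ℓ where
    private
      module A = Structure A
      module B = Structure B
    field
      ⟦_⟧     : A.Carrier → B.Carrier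
      op-homo : ∀ {n} (f : Operations n) (xs : Vec A.Carrier n) →
                ⟦ A.op f xs ⟧ ≡ B.op f (map ⟦_⟧ xs)
      rel-pres : ∀ {n} (R : Relations n) (xs : Vec A.Carrier n) →
                 xs ∈ A.rel R → map ⟦_⟧ xs ∈ B.rel R

  open Hom

  idₕ : (A : Structure S) → Hom A A
  idₕ A = record
    { ⟦_⟧      = id
    ; op-homo  = λ f xs → cong (Structure.op A f) (sym (map-id xs))
    ; rel-pres = λ R xs → subst (Structure.rel A R) (sym (map-id xs))
    }

  infixr 9 _∘ₕ_

  _∘ₕ_ : {A B C : Structure S} → Hom B C → Hom A B → Hom A C
  _∘ₕ_ {C = C} g h = record
    { ⟦_⟧      = ⟦ g ⟧ ∘ ⟦ h ⟧
    ; op-homo  = λ f xs →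
        trans (cong ⟦ g ⟧ (op-homo h f xs))
        (trans (op-homo g f (map ⟦ h ⟧ xs))
               (cong (Structure.op C f) (sym (map-∘ ⟦ g ⟧ ⟦ h ⟧ xs))))
    ; rel-pres = λ R xs r →
        subst (Structure.rel C R) (sym (map-∘ ⟦ g ⟧ ⟦ h ⟧ xs))
              (rel-pres g R (map ⟦ h ⟧ xs) (rel-pres h R xs r))
    }

------------------------------------------------------------------------
-- Infima and suprema of indexed families

module _ {c ℓ₁ ℓ₂ : Level} (P : Poset c ℓ₁ ℓ₂) where

  open Poset P renaming (Carrier to ∣P∣)

  record IsInfimum {i : Level} {I : Set i} (x : I → ∣P∣) (m : ∣P∣)
                   : Set (c ⊔ ℓ₂ ⊔ i) where
    field
      lower    : ∀ j → m ≤ x j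
      greatest : ∀ y → (∀ j → y ≤ x j) → y ≤ m

  record IsSupremum {i : Level} {I : Set i} (x : I → ∣P∣) (s : ∣P∣)
                    : Set (c ⊔ ℓ₂ ⊔ i) where
    field
      upper : ∀ j → x j ≤ s
      least : ∀ y → (∀ j → x j ≤ y) → s ≤ y

  record IsDirected {i : Level} {I : Set i} (x : I → ∣P∣) : Set (ℓ₂ ⊔ i) where
    field
      inhabitant : I
      bound      : ∀ j k → ∃[ l ] (x j ≤ x l × x k ≤ x l)

-- Preservation of infima includes the empty one (the top element), and entails
-- monotonicity, hence compatibility with the equality of the posets.
module _ {c ℓ₁ ℓ₂ d ℓ₃ ℓ₄ : Level} (i : Level)
         (P : Poset c ℓ₁ ℓ₂) (Q : Poset d ℓ₃ ℓ₄)
         (h : Poset.Carrier P → Poset.Carrier Q) where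

  PreservesInfima : Set (c ⊔ ℓ₂ ⊔ d ⊔ ℓ₄ ⊔ suc i)
  PreservesInfima =
    {I : Set i} (x : I → Poset.Carrier P) (m : Poset.Carrier P) →
    IsInfimum P x m → IsInfimum Q (h ∘ x) (h m)

  PreservesDirectedSuprema : Set (c ⊔ ℓ₂ ⊔ d ⊔ ℓ₄ ⊔ suc i)
  PreservesDirectedSuprema =
    {I : Set i} (x : I → Poset.Carrier P) (s : Poset.Carrier P) →
    IsDirected P x → IsSupremum P x s → IsSupremum Q (h ∘ x) (h s)

------------------------------------------------------------------------
-- AL

module _ {ℓ : Level} (P : Poset ℓ ℓ ℓ) where

  open Poset P renaming (Carrier to ∣P∣)

  IsCompact : Pred ∣P∣ (suc ℓ)
  IsCompact c = {I : Set ℓ} (x : I → ∣P∣) (s : ∣P∣) →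
                IsDirected P x → IsSupremum P x s → c ≤ s → ∃[ j ] c ≤ x j

  record IsAlgebraicLattice : Set (suc ℓ) where
    field
      infimum   : {I : Set ℓ} (x : I → ∣P∣) → ∃ (IsInfimum P x)
      supremum  : {I : Set ℓ} (x : I → ∣P∣) → ∃ (IsSupremum P x)
      algebraic : ∀ a → IsSupremum P {I = Σ[ c ∈ ∣P∣ ] (IsCompact c × c ≤ a)} proj₁ a

record AlgebraicLattice (ℓ : Level) : Set (suc ℓ) where
  field
    poset              : Poset ℓ ℓ ℓ
    isAlgebraicLattice : IsAlgebraicLattice poset

  open Poset poset public
  open IsAlgebraicLattice isAlgebraicLattice public

record ALHom {ℓ : Level} (L M : AlgebraicLattice ℓ) : Set (suc ℓ) where
  private
    module L = AlgebraicLattice L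
    module M = AlgebraicLattice M
  field
    ⟦_⟧                        : L.Carrier → M.Carrier
    preserves-infima           : PreservesInfima ℓ L.poset M.poset ⟦_⟧
    preserves-directed-suprema : PreservesDirectedSuprema ℓ L.poset M.poset ⟦_⟧

------------------------------------------------------------------------
-- Filter pairs

-- Morphisms of both categories are compared pointwise, so functoriality
-- includes the congruence law `F-cong`.
record ContravariantFunctor {ℓ : Level} (S : Signature ℓ) : Set (suc ℓ) where
  field
    F₀ : Structure S → AlgebraicLattice ℓ
    F₁ : {A B : Structure S} → Hom A B → ALHom (F₀ B) (F₀ A)

  ∣_∣ : Structure S → Set ℓ
  ∣ A ∣ = AlgebraicLattice.Carrier (F₀ A)

  _≈_ : {A : Structure S} → ∣ A ∣ → ∣ A ∣ → Set ℓ
  _≈_ {A} = AlgebraicLattice._≈_ (F₀ A)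

  _* : {A B : Structure S} → Hom A B → ∣ B ∣ → ∣ A ∣
  h * = ALHom.⟦_⟧ (F₁ h)

  field
    F-cong : {A B : Structure S} (g h : Hom A B) → Hom.⟦ g ⟧ ≗ Hom.⟦ h ⟧ →
             ∀ b → _≈_ {A} ((g *) b) ((h *) b)
    F-id   : (A : Structure S) → ∀ a → _≈_ {A} ((idₕ A *) a) a
    F-∘    : {A B C : Structure S} (g : Hom B C) (h : Hom A B) →
             ∀ c → _≈_ {A} (((g ∘ₕ h) *) c) ((h *) ((g *) c))

record FilterPair {ℓ : Level} (S : Signature ℓ) : Set (suc ℓ) where
  field
    G : ContravariantFunctor S

  open ContravariantFunctor G public

  𝒫 : Structure S → Poset (suc ℓ) ℓ ℓ
  𝒫 A = ⊆-poset (Carrier A) ℓ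

  field
    i : (A : Structure S) → ∣ A ∣ → Pred (Carrier A) ℓ
    i-infima : (A : Structure S) →
               PreservesInfima ℓ (AlgebraicLattice.poset (F₀ A)) (𝒫 A) (i A)
    i-directed-suprema :
      (A : Structure S) →
      PreservesDirectedSuprema ℓ (AlgebraicLattice.poset (F₀ A)) (𝒫 A) (i A)
    -- `f ⊢ P` is the library's notation for the preimage of P under f.
    i-natural : {A B : Structure S} (h : Hom A B) (b : ∣ B ∣) →
                i A ((h *) b) ≐ (Hom.⟦ h ⟧ ⊢ i B b)

------------------------------------------------------------------------
-- Abstract logics: pairs (A , ⊩) with `IsTarskian A _⊩_`

module _ {ℓ : Level} {X : Set ℓ} where

  IsFinite : Pred X ℓ → Set ℓ
  IsFinite Δ = Σ[ xs ∈ List X ] (Δ ≐ (_∈ₗ xs))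

  _[_] : {Y : Set ℓ} → (X → Y) → Pred X ℓ → Pred Y ℓ
  (f [ Γ ]) y = ∃[ x ] (x ∈ Γ × y ≡ f x)

record IsTarskian {ℓ : Level} {S : Signature ℓ} (A : Structure S)
                  (_⊩_ : REL (Pred (Carrier A) ℓ) (Carrier A) ℓ) : Set (suc ℓ) where
  field
    reflexivity   : ∀ {Γ φ} → φ ∈ Γ → Γ ⊩ φ
    cut           : ∀ {Γ Δ φ} → Γ ⊩ φ → (∀ {ψ} → ψ ∈ Γ → Δ ⊩ ψ) → Δ ⊩ φ
    monotonicity  : ∀ {Γ Δ φ} → Γ ⊆ Δ → Γ ⊩ φ → Δ ⊩ φ
    finitarity    : ∀ {Γ φ} → Γ ⊩ φ → ∃[ Δ ] (IsFinite Δ × Δ ⊆ Γ × Δ ⊩ φ)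
    structurality : ∀ {Γ φ} (σ : Hom A A) → Γ ⊩ φ →
                    (Hom.⟦ σ ⟧ [ Γ ]) ⊩ Hom.⟦ σ ⟧ φ

Consequence : {ℓ : Level} {S : Signature ℓ} → FilterPair S → (A : Structure S) →
              REL (Pred (Carrier A) ℓ) (Carrier A) ℓ
Consequence F A Γ φ = ∀ a → Γ ⊆ i A a → φ ∈ i A a
  where open FilterPair F

{-# OPTIONS --safe #-}

-- The closure of Γ is the infimum in G(A) of all a with Γ ⊆ i a; since i
-- preserves infima, Γ ⊢ φ iff φ ∈ i (closure Γ).  Finitarity: the closures of
-- the finite subsets of Γ form a directed family, and i sends its supremum s to
-- the supremum of their images in 𝒫(A), which is contained in their union.
-- As Γ ⊆ i s, a consequence of Γ lies in i s, hence in i of the closure of some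
-- finite subset.
module Submission where

open import Defs
open import Level using (Level)
open import Data.List.Base using (List; []; _++_) renaming ([_] to singleton)
open import Data.List.Membership.Propositional renaming (_∈_ to _∈ₗ_) using ()
open import Data.List.Membership.Propositional.Properties using (∈-++⁺ˡ; ∈-++⁺ʳ; ∈-++⁻)
open import Data.List.Relation.Unary.Any using (here)
open import Data.Product.Base using (Σ-syntax; ∃-syntax; _×_; _,_; proj₁; proj₂)
open import Data.Sum.Base using ([_,_]′)
open import Function.Base using (id; _∘_)
open import Relation.Binary.PropositionalEquality using (refl)
open import Relation.Unary using (Pred; _∈_; _⊆_; ⋃)

module _ {ℓ : Level} {S : Signature ℓ} (F : FilterPair S) (A : Structure S) where

  open FilterPair F
  open Structure A using (Carrier)
  open AlgebraicLattice (F₀ A) using (poset; _≤_; infimum; supremum)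

  _⊢_ : Pred Carrier ℓ → Carrier → Set ℓ
  _⊢_ = Consequence F A

  Above : Pred Carrier ℓ → Set ℓ
  Above Γ = Σ[ a ∈ ∣ A ∣ ] Γ ⊆ i A a

  closure : Pred Carrier ℓ → ∣ A ∣
  closure Γ = proj₁ (infimum {I = Above Γ} proj₁)

  closure-isInfimum : ∀ Γ → IsInfimum poset {I = Above Γ} proj₁ (closure Γ)
  closure-isInfimum Γ = proj₂ (infimum proj₁)

  i-closure-isInfimum : ∀ Γ → IsInfimum (𝒫 A) {I = Above Γ} (i A ∘ proj₁) (i A (closure Γ))
  i-closure-isInfimum Γ = i-infima A proj₁ (closure Γ) (closure-isInfimum Γ)

  -- `Γ` is itself a lower bound in `𝒫 A` of the sets `i A a` with `a` in `Above Γ`, and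
  -- `i A (closure Γ)` is the greatest such bound.
  closure-extensive : ∀ Γ → Γ ⊆ i A (closure Γ)
  closure-extensive Γ = IsInfimum.greatest (i-closure-isInfimum Γ) Γ proj₂

  closure-mono : ∀ {Γ Δ} → Γ ⊆ Δ → closure Γ ≤ closure Δ
  closure-mono {Γ} {Δ} Γ⊆Δ = IsInfimum.greatest (closure-isInfimum Δ) (closure Γ)
    λ (a , Δ⊆a) → IsInfimum.lower (closure-isInfimum Γ) (a , λ γ → Δ⊆a (Γ⊆Δ γ))

  ∈-closure⇒⊢ : ∀ {Γ φ} → φ ∈ i A (closure Γ) → Γ ⊢ φ
  ∈-closure⇒⊢ {Γ} φ∈ a Γ⊆a = IsInfimum.lower (i-closure-isInfimum Γ) (a , Γ⊆a) φ∈

  -- Lists, rather than predicates satisfying `IsFinite`, keep this type in `Set ℓ`, so that it can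
  -- index a supremum in `G(A)`.
  FiniteSubset : Pred Carrier ℓ → Set ℓ
  FiniteSubset Γ = Σ[ xs ∈ List Carrier ] (_∈ₗ xs) ⊆ Γ

  finiteClosure : ∀ {Γ} → FiniteSubset Γ → ∣ A ∣
  finiteClosure (xs , _) = closure (_∈ₗ xs)

  finiteClosure-directed : ∀ Γ → IsDirected poset (finiteClosure {Γ})
  finiteClosure-directed Γ = record
    { inhabitant = [] , λ ()
    ; bound      = λ (xs , xs⊆Γ) (ys , ys⊆Γ) →
        (xs ++ ys , λ z∈ → [ xs⊆Γ , ys⊆Γ ]′ (∈-++⁻ xs z∈))
        , closure-mono ∈-++⁺ˡ
        , closure-mono (∈-++⁺ʳ xs)
    }

  finitary : ∀ {Γ φ} → Γ ⊢ φ → ∃[ Δ ] (IsFinite Δ × Δ ⊆ Γ × Δ ⊢ φ)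
  finitary {Γ} {φ} Γ⊢φ =
    let (xs , xs⊆Γ) , φ∈ = φ∈union
    in (_∈ₗ xs) , (xs , id , id) , xs⊆Γ , ∈-closure⇒⊢ φ∈
    where
    s : ∣ A ∣
    s = proj₁ (supremum (finiteClosure {Γ}))

    i-s-isSupremum : IsSupremum (𝒫 A) (i A ∘ finiteClosure {Γ}) (i A s)
    i-s-isSupremum = i-directed-suprema A finiteClosure s
      (finiteClosure-directed Γ) (proj₂ (supremum finiteClosure))

    Γ⊆i-s : Γ ⊆ i A s
    -- Each `ψ` already lies in the closure of the finite subset consisting of `ψ` alone.
    Γ⊆i-s {ψ} ψ∈Γ = IsSupremum.upper i-s-isSupremum
      (singleton ψ , λ { (here refl) → ψ∈Γ })
      (closure-extensive (_∈ₗ singleton ψ) (here refl))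

    union : Pred Carrier ℓ
    union = ⋃ (FiniteSubset Γ) (i A ∘ finiteClosure)

    φ∈union : φ ∈ union
    -- Leastness is tested against arbitrary subsets of `A`, so the union may serve as upper bound
    -- without being of the form `i A a`.
    φ∈union = IsSupremum.least i-s-isSupremum union (λ j z∈ → j , z∈) (Γ⊢φ s Γ⊆i-s)

proposition2p3 : {ℓ : Level} {S : Signature ℓ} (F : FilterPair S) (A : Structure S) →
    IsTarskian A (Consequence F A)
proposition2p3 F A = record
  { reflexivity   = λ φ∈Γ a Γ⊆a → Γ⊆a φ∈Γ
  ; cut           = λ Γ⊢φ Δ⊢Γ a Δ⊆a → Γ⊢φ a λ ψ∈Γ → Δ⊢Γ ψ∈Γ a Δ⊆a
  ; monotonicity  = λ Γ⊆Δ Γ⊢φ a Δ⊆a → Γ⊢φ a λ γ → Δ⊆a (Γ⊆Δ γ)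
  ; finitarity    = finitary F A
  -- By naturality `i A ((σ *) a)` is the preimage of `i A a` under `σ`, so the hypothesis is
  -- applied at `(σ *) a`.
  ; structurality = λ σ Γ⊢φ a σΓ⊆a →
      proj₁ (i-natural σ a)
        (Γ⊢φ ((σ *) a) λ {ψ} ψ∈Γ → proj₂ (i-natural σ a) (σΓ⊆a (ψ , ψ∈Γ , refl)))
  }
  where open FilterPair F
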